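{- Let $D\subset(\mathbb Z_{\ge 0})^2$ be a Young diagram and let $\overline{D}=(\mathbb Z_{\ge 0})^2\setminus D$. Let $a$ and $l$ be non-negative integers. Then the number of boxes $c\in D$ such that $a(c)=a$ and $l(c)=l$ is one less than the number of boxes $c\in\overline{D}$ such that $a(c)=a$ and $l(c)=l$.
   Context: A Young diagram is a finite subset $D\subset(\mathbb Z_{\ge 0})^2$ such that if $(x,y)\in D$, $0\le x'\le x$ and $0\le y'\le y$, then $(x',y')\in D$. Elements of $(\mathbb Z_{\ge 0})^2$ are called boxes; the first coordinate is horizontal (increasing to the east), the second is vertical (increasing to the north). Arm and leg lengths. For $c=(x,y)\in D$: $a(c)$ is the number of boxes $(x',y)\in D$ with $x'>x$, and $l(c)$ is the number of boxes $(x,y')\in D$ with $y'>y$. For $c=(x,y)\in\overline{D}$: $a(c)$ is the number of boxes $(x',y)\in\overline{D}$ with $0\le x'<x$, and $l(c)$ is the number of boxes $(x,y')\in\overline{D}$ with $0\le y'<y$. -}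

module Defs where

open import Data.Nat using (ℕ; _≤_; _<_; _>_)
open import Data.Product using (_×_; _,_; ∃)
open import Data.List using (List; length)
open import Data.List.Membership.Propositional using (_∈_)
open import Data.List.Relation.Unary.Unique.Propositional using (Unique)
open import Data.List.Relation.Binary.BagAndSetEquality using (∼bag⇒↭)
open import Data.List.Membership.Propositional.Properties.WithK using (unique∧set⇒bag)
open import Data.List.Relation.Binary.Permutation.Propositional.Properties using (↭-length)
open import Function using (_⇔_)
open import Function.Properties.Equivalence using (⇔-isEquivalence)
open import Level using (0ℓ)
open import Relation.Binary using (IsEquivalence)
open import Relation.Binary.PropositionalEquality using (_≡_; trans; sym)
open import Relation.Unary using (Pred; ∁)

-- "The number of x satisfying P is n".  Counting the entries of a
-- repetition-free list, rather than the elements of Σ A P, means that P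
-- need not be proof-irrelevant.
record Count {A : Set} (P : Pred A 0ℓ) (n : ℕ) : Set where
  field
    elements : List A
    unique   : Unique elements
    length≡n : length elements ≡ n
    exact    : ∀ x → x ∈ elements ⇔ P x

-- Hence "Count P n" may be read as an equation "#P = n".
Count-functional : {A : Set} {P : Pred A 0ℓ} {m n : ℕ} →
                   Count P m → Count P n → m ≡ n
Count-functional p q =
  trans (sym P.length≡n)
    (trans (↭-length (∼bag⇒↭ (unique∧set⇒bag P.unique Q.unique
             (λ {x} → ⇔.trans (P.exact x) (⇔.sym (Q.exact x))))))
      Q.length≡n)
  where
  module P = Count p
  module Q = Count q
  module ⇔ = IsEquivalence ⇔-isEquivalence

Finite : {A : Set} → Pred A 0ℓ → Set
Finite P = ∃ λ n → Count P n

Box : Set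
Box = ℕ × ℕ

record YoungDiagram : Set₁ where
  field
    boxes      : Pred Box 0ℓ
    finite     : Finite boxes
    downClosed : ∀ {x y x′ y′} → boxes (x , y) → x′ ≤ x → y′ ≤ y → boxes (x′ , y′)

  complement : Pred Box 0ℓ
  complement = ∁ boxes

open YoungDiagram public

-- Arm and leg lengths are given by their graphs: the last argument is the
-- length.  The "In" versions are for boxes of the diagram, the "Out"
-- versions for boxes of its complement.

ArmIn LegIn ArmOut LegOut : YoungDiagram → Box → ℕ → Set

ArmIn  D (x , y) = Count {Box} λ (x′ , y′) → boxes D (x′ , y′) × y′ ≡ y × x′ > x
LegIn  D (x , y) = Count {Box} λ (x′ , y′) → boxes D (x′ , y′) × x′ ≡ x × y′ > y

ArmOut D (x , y) = Count {Box} λ (x′ , y′) → complement D (x′ , y′) × y′ ≡ y × x′ < x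
LegOut D (x , y) = Count {Box} λ (x′ , y′) → complement D (x′ , y′) × x′ ≡ x × y′ < y

{-# OPTIONS --safe #-}
module Submission where

-- Let h(y) be the length of row y of D.  In row y there is at most one box of
-- D with arm a; it exists and has leg l iff F(y) and not G(y), where
--   F(y) : h(y) ≤ h(y + l) + a,   G(y) : h(y) ≤ h(y + l + 1) + a.
-- In row y + l there is exactly one box of the complement with arm a, and it
-- has leg l iff F(y) and (y = 0 or not G(y - 1)).  Since h is decreasing,
-- G(y) implies F(y) and F(y + 1), so in the sequence F(0), G(0), F(1), G(1), …
-- the first boxes are the passages from true to false and the second ones the
-- passages from false (also put in front of F(0)) to true.  They alternate and
-- the sequence is eventually true, so there is one more of the latter.

open import Defs
open import Data.Empty using (⊥-elim)
open import Data.List using (_∷_; upTo; map)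
open import Data.List.Extrema.Nat using (max; xs≤max)
open import Data.List.Membership.Propositional using (_∈_)
open import Data.List.Membership.Propositional.Properties
  using (∈-map⁺; ∈-map⁻; ∈-upTo⁺; ∈-upTo⁻)
open import Data.List.Properties using (length-map; length-upTo)
import Data.List.Relation.Unary.All as All
open import Data.List.Relation.Unary.AllPairs using (_∷_)
open import Data.List.Relation.Unary.Any using (here; there)
open import Data.List.Relation.Unary.Unique.Propositional.Properties
  using (upTo⁺; map⁺)
open import Data.Nat using (ℕ; zero; suc; _+_; _∸_; _≤_; _<_; z≤n; s≤s; _≟_; _≤?_)
open import Data.Nat.Properties
open import Data.Product using (_×_; _,_; ∃; proj₁; proj₂)
open import Data.Product.Properties using (≡-dec)
open import Data.List.Membership.DecPropositional (≡-dec _≟_ _≟_) using (_∈?_)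
open import Data.Sum using (_⊎_; inj₁; inj₂)
open import Function using (_∘_; _⇔_; mk⇔; module Equivalence)
open import Function.Definitions using (Injective)
open import Level using (0ℓ)
open import Relation.Binary.PropositionalEquality
  using (_≡_; refl; sym; trans; cong; cong₂; subst)
open import Relation.Nullary using (¬_; yes; no)
import Relation.Nullary.Decidable as Dec
open import Relation.Unary using (Pred; Decidable)

open Equivalence

private variable
  A B : Set
  P Q : Pred A 0ℓ
  k m n : ℕ

-- Counting: transport along injections, segments, initial segments

Count-cong : (∀ x → P x ⇔ Q x) → Count P n → Count Q n
Count-cong P⇔Q c = record
  { elements = elements
  ; unique   = unique
  ; length≡n = length≡n
  ; exact    = λ x → mk⇔ (to (P⇔Q x) ∘ to (exact x)) (from (exact x) ∘ from (P⇔Q x))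
  }
  where open Count c

Count-image : {P : Pred A 0ℓ} {Q : Pred B 0ℓ} {f : A → B} → Injective _≡_ _≡_ f →
              (∀ y → Q y ⇔ ∃ λ x → y ≡ f x × P x) → Count P n → Count Q n
Count-image {f = f} f-inj Q⇔ c = record
  { elements = map f elements
  ; unique   = map⁺ f-inj unique
  ; length≡n = trans (length-map f elements) length≡n
  ; exact    = λ y → mk⇔
      (λ y∈ → let x , x∈ , y≡fx = ∈-map⁻ f y∈ in from (Q⇔ y) (x , y≡fx , to (exact x) x∈))
      (λ q → let x , y≡fx , p = to (Q⇔ y) q in
             subst (_∈ map f elements) (sym y≡fx) (∈-map⁺ f (from (exact x) p)))
  }
  where
  open Count c

Count-< : ∀ n → Count (_< n) n
Count-< n = record
  { elements = upTo n
  ; unique   = upTo⁺ n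
  ; length≡n = length-upTo n
  ; exact    = λ x → mk⇔ ∈-upTo⁻ ∈-upTo⁺
  }

-- Translating by `m` reduces to counting `_< n ∸ m`, and a count is unique. Arm and leg conditions
-- thereby become equations without truncated subtraction.
Count-segment : {f : ℕ → A} → Injective _≡_ _≡_ f → m ≤ n →
                (∀ x → P x ⇔ ∃ λ i → x ≡ f i × m ≤ i × i < n) →
                Count P k ⇔ m + k ≡ n
Count-segment {m = m} {n = n} {P = P} {f = f} f-inj m≤n P⇔ = mk⇔
  (λ c → trans (cong (m +_) (Count-functional c total)) (m+[n∸m]≡n m≤n))
  (λ m+k≡n → subst (Count P) (trans (cong (_∸ m) (sym m+k≡n)) (m+n∸m≡n m _)) total)
  where
  shift : ∀ x → P x ⇔ ∃ λ j → x ≡ f (m + j) × j < n ∸ m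
  shift x = mk⇔
    (λ p → let i , x≡fi , m≤i , i<n = to (P⇔ x) p in
           i ∸ m , trans x≡fi (cong f (sym (m+[n∸m]≡n m≤i))) , ∸-monoˡ-< i<n m≤i)
    (λ (j , x≡ , j<) → from (P⇔ x)
           (m + j , x≡ , m≤m+n m j , subst (m + j <_) (m+[n∸m]≡n m≤n) (+-monoʳ-< m j<)))

  total : Count P (n ∸ m)
  total = Count-image (+-cancelˡ-≡ m _ _ ∘ f-inj) shift (Count-< (n ∸ m))

Count-below-suc : {P : Pred ℕ 0ℓ} → P m →
                  Count (λ i → P i × i < m) n → Count (λ i → P i × i < suc m) (suc n)
Count-below-suc {m} {P = P} Pm c = record
  { elements = m ∷ elements
  ; unique   = All.tabulate (λ {i} i∈ m≡i → <-irrefl (sym m≡i) (proj₂ (to (exact i) i∈))) ∷ unique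
  ; length≡n = cong suc length≡n
  ; exact    = λ i → mk⇔
      (λ { (here refl) → Pm , ≤-refl
         ; (there i∈) → let p , i<m = to (exact i) i∈ in p , m<n⇒m<1+n i<m })
      (λ { (p , i<1+m) → case-< i p (m<1+n⇒m<n∨m≡n i<1+m) })
  }
  where
  open Count c
  case-< : ∀ i → P i → i < m ⊎ i ≡ m → i ∈ m ∷ elements
  case-< i p (inj₁ i<m) = there (from (exact i) (p , i<m))
  case-< i p (inj₂ i≡m) = here i≡m

Count-below-skip : {P : Pred ℕ 0ℓ} → ¬ P m →
                   Count (λ i → P i × i < m) n → Count (λ i → P i × i < suc m) n
Count-below-skip {m} {P = P} ¬Pm = Count-cong λ i → mk⇔
  (λ (p , i<m) → p , m<n⇒m<1+n i<m)
  (λ (p , i<1+m) → p , ≤∧≢⇒< (≤-pred i<1+m) (λ { refl → ¬Pm p }))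

Count-below-zero : {P : Pred ℕ 0ℓ} → Count (λ i → P i × i < 0) 0
Count-below-zero = Count-cong (λ i → mk⇔ (λ ()) (λ ())) (Count-< 0)

-- Alternating passages in the interleaved sequence

Fall Rise : Pred ℕ 0ℓ → Pred ℕ 0ℓ → Pred ℕ 0ℓ
Fall F G i       = F i × ¬ G i
Rise F G zero    = F zero
Rise F G (suc i) = F (suc i) × ¬ G i

module Alternation {F G : Pred ℕ 0ℓ} (F? : Decidable F) (G? : Decidable G)
                   (G⇒F : ∀ i → G i → F i) (G⇒F+ : ∀ i → G i → F (suc i)) where

  FallsBelow RisesBelow : ℕ → ℕ → Set
  FallsBelow N = Count (λ i → Fall F G i × i < N)
  RisesBelow N = Count (λ i → Rise F G i × i < N)

  -- The induction invariant, with the sequence cut just after `F N`: rises are counted up to `N`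
  -- inclusive, falls only below `N`. Rises are one ahead exactly when the last value seen is true.
  Balanced : ℕ → Set
  Balanced N = ∃ λ n → FallsBelow N n ×
    (F N → RisesBelow (suc N) (suc n)) × (¬ F N → RisesBelow (suc N) n)

  balanced : ∀ N → Balanced N
  balanced zero = 0 , Count-below-zero ,
    (λ f → Count-below-suc f Count-below-zero) , (λ ¬f → Count-below-skip ¬f Count-below-zero)
  balanced (suc N) with balanced N | G? N | F? N
  -- `G N` forces both neighbours `F N` and `F (suc N)`, so no passage occurs here.
  ... | n , falls , risesF , _ | yes g | _ = n , Count-below-skip (λ (_ , ¬g) → ¬g g) falls ,
    (λ _ → Count-below-skip (λ (_ , ¬g) → ¬g g) (risesF (G⇒F N g))) ,
    (λ ¬f → ⊥-elim (¬f (G⇒F+ N g)))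
  -- A fall at `N` uses up the lead of the rises; only a rise at `suc N` restores it.
  ... | n , falls , risesF , _ | no ¬g | yes f = suc n , Count-below-suc (f , ¬g) falls ,
    (λ f+ → Count-below-suc (f+ , ¬g) (risesF f)) ,
    (λ ¬f+ → Count-below-skip (¬f+ ∘ proj₁) (risesF f))
  ... | n , falls , _ , rises¬F | no ¬g | no ¬f = n , Count-below-skip (¬f ∘ proj₁) falls ,
    (λ f+ → Count-below-suc (f+ , ¬g) (rises¬F ¬f)) ,
    (λ ¬f+ → Count-below-skip (¬f+ ∘ proj₁) (rises¬F ¬f))

  rises≡1+falls : ∀ N → (∀ i → N ≤ i → G i) →
                  ∃ λ n → Count (Fall F G) n × Count (Rise F G) (suc n)
  rises≡1+falls N G-from-N with balanced N
  ... | n , falls , risesF , _ =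
    n , Count-cong (λ i → mk⇔ proj₁ (λ p → p , fall< p)) falls
      , Count-cong (λ i → mk⇔ proj₁ (λ p → p , rise< i p)) (risesF (G⇒F N (G-from-N N ≤-refl)))
    where
    ¬G⇒< : ∀ {i} → ¬ G i → i < N
    ¬G⇒< ¬g = ≰⇒> (¬g ∘ G-from-N _)

    fall< : ∀ {i} → Fall F G i → i < N
    fall< (_ , ¬g) = ¬G⇒< ¬g

    -- A rise at `suc i` depends on `G i`, so rises may occur one index later than falls, hence the
    -- bound `suc N`.
    rise< : ∀ i → Rise F G i → i < suc N
    rise< zero    _        = s≤s z≤n
    rise< (suc i) (_ , ¬g) = s≤s (¬G⇒< ¬g)

-- Row and column lengths; arms and legs as equations

threshold : {P : Pred ℕ 0ℓ} → Decidable P → (∀ {i j} → i ≤ j → P j → P i) →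
            ∀ b → ¬ P b → ∃ λ t → ∀ i → P i ⇔ i < t
threshold P? down zero    ¬Pb = 0 , λ i → mk⇔ (⊥-elim ∘ ¬Pb ∘ down z≤n) λ ()
threshold P? down (suc b) ¬Pb with P? b
-- The search descends through failing indices, so the successor of the first hit fails; downward
-- closure settles all other indices.
... | yes Pb = suc b , λ i → mk⇔ (λ p → ≰⇒> λ b<i → ¬Pb (down b<i p)) (λ i≤b → down (≤-pred i≤b) Pb)
... | no ¬Pb′ = threshold P? down b ¬Pb′

Finite⇒bounded : {P : Pred A 0ℓ} → Finite P → (f : A → ℕ) → ∃ λ b → ∀ x → P x → f x < b
Finite⇒bounded (_ , c) f = suc (max 0 (map f elements)) ,
  λ x p → s≤s (All.lookup (xs≤max 0 (map f elements)) (∈-map⁺ f (from (exact x) p)))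
  where open Count c

module Profile (D : YoungDiagram) where

  -- Decidability comes from searching the finite enumeration of the diagram.
  boxes? : Decidable (boxes D)
  boxes? c = Dec.map (exact c) (c ∈? elements)
    where open Count (proj₂ (finite D))

  width  = Finite⇒bounded (finite D) proj₁
  height = Finite⇒bounded (finite D) proj₂

  row-threshold : ∀ y → ∃ λ t → ∀ x → boxes D (x , y) ⇔ x < t
  row-threshold y = threshold (λ x → boxes? (x , y)) (λ i≤j p → downClosed D p i≤j ≤-refl)
    (proj₁ width) (<-irrefl refl ∘ proj₂ width _)

  col-threshold : ∀ x → ∃ λ t → ∀ y → boxes D (x , y) ⇔ y < t
  col-threshold x = threshold (λ y → boxes? (x , y)) (λ i≤j p → downClosed D p ≤-refl i≤j)
    (proj₁ height) (<-irrefl refl ∘ proj₂ height _)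

  row col : ℕ → ℕ
  row y = proj₁ (row-threshold y)
  col x = proj₁ (col-threshold x)

  ∈⇔<row : ∀ {x y} → boxes D (x , y) ⇔ x < row y
  ∈⇔<row = proj₂ (row-threshold _) _

  ∈⇔<col : ∀ {x y} → boxes D (x , y) ⇔ y < col x
  ∈⇔<col = proj₂ (col-threshold _) _

  -- Both inequalities express that `(x , y)` is a box: `row` and `col` are conjugate partitions.
  <row⇒<col : ∀ {x y} → x < row y → y < col x
  <row⇒<col = to ∈⇔<col ∘ from ∈⇔<row

  <col⇒<row : ∀ {x y} → y < col x → x < row y
  <col⇒<row = to ∈⇔<row ∘ from ∈⇔<col

  row-antitone : ∀ {y y′} → y ≤ y′ → row y′ ≤ row y
  row-antitone y≤y′ = ≮⇒≥ λ r<r′ →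
    <-irrefl refl (to ∈⇔<row (downClosed D (from ∈⇔<row r<r′) ≤-refl y≤y′))

  row-vanishes : ∀ y → proj₁ height ≤ y → row y ≡ 0
  row-vanishes y h≤y = n≤0⇒n≡0 (≮⇒≥ λ 0<r →
    <-irrefl refl (<-≤-trans (proj₂ height _ (from ∈⇔<row 0<r)) h≤y))

  ArmIn⇔ : ∀ {x y a} → boxes D (x , y) → ArmIn D (x , y) a ⇔ suc x + a ≡ row y
  ArmIn⇔ {x} {y} c∈ = Count-segment {f = _, y} (cong proj₁) (to ∈⇔<row c∈) λ (x′ , y′) → mk⇔
    (λ { (b∈ , refl , x<x′) → x′ , refl , x<x′ , to ∈⇔<row b∈ })
    (λ { (x′ , refl , x<x′ , x′<r) → from ∈⇔<row x′<r , refl , x<x′ })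

  LegIn⇔ : ∀ {x y l} → boxes D (x , y) → LegIn D (x , y) l ⇔ suc y + l ≡ col x
  LegIn⇔ {x} {y} c∈ = Count-segment {f = x ,_} (cong proj₂) (to ∈⇔<col c∈) λ (x′ , y′) → mk⇔
    (λ { (b∈ , refl , y<y′) → y′ , refl , y<y′ , to ∈⇔<col b∈ })
    (λ { (y′ , refl , y<y′ , y′<t) → from ∈⇔<col y′<t , refl , y<y′ })

  ArmOut⇔ : ∀ {x y a} → complement D (x , y) → ArmOut D (x , y) a ⇔ row y + a ≡ x
  ArmOut⇔ {x} {y} c∉ = Count-segment {f = _, y} (cong proj₁) (≮⇒≥ (c∉ ∘ from ∈⇔<row))
    λ (x′ , y′) → mk⇔
    (λ { (b∉ , refl , x′<x) → x′ , refl , ≮⇒≥ (b∉ ∘ from ∈⇔<row) , x′<x })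
    (λ { (x′ , refl , r≤x′ , x′<x) → ≤⇒≯ r≤x′ ∘ to ∈⇔<row , refl , x′<x })

  LegOut⇔ : ∀ {x y l} → complement D (x , y) → LegOut D (x , y) l ⇔ col x + l ≡ y
  LegOut⇔ {x} {y} c∉ = Count-segment {f = x ,_} (cong proj₂) (≮⇒≥ (c∉ ∘ from ∈⇔<col))
    λ (x′ , y′) → mk⇔
    (λ { (b∉ , refl , y′<y) → y′ , refl , ≮⇒≥ (b∉ ∘ from ∈⇔<col) , y′<y })
    (λ { (y′ , refl , t≤y′ , y′<y) → ≤⇒≯ t≤y′ ∘ to ∈⇔<col , refl , y′<y })

-- Boxes with given arm and leg as falls and rises

module ArmLeg (D : YoungDiagram) (a l : ℕ) where
  open Profile D

  F G : Pred ℕ 0ℓ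
  F y = row y ≤ row (y + l) + a
  G y = row y ≤ row (suc y + l) + a

  G⇒F : ∀ y → G y → F y
  G⇒F y g = ≤-trans g (+-monoˡ-≤ a (row-antitone (n≤1+n (y + l))))

  G⇒F+ : ∀ y → G y → F (suc y)
  G⇒F+ y g = ≤-trans (row-antitone (n≤1+n y)) g

  open Alternation {F} {G}
    (λ y → row y ≤? row (y + l) + a) (λ y → row y ≤? row (suc y + l) + a) G⇒F G⇒F+
    using (rises≡1+falls)

  -- Cancelling `a`, `F y` says that `(x , y + l)` is a box and `G y` that `(x , suc y + l)` is one;
  -- a fall means that column `x` ends between them.
  leg⇔fall : ∀ {x y} → suc x + a ≡ row y → suc y + l ≡ col x ⇔ Fall F G y
  leg⇔fall {x} {y} arm = mk⇔
    (λ leg → subst (_≤ row (y + l) + a) arm (+-monoˡ-≤ a (<col⇒<row (≤-reflexive leg))) ,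
             λ g → <-irrefl leg (<row⇒<col (cancel g)))
    (λ (f , ¬g) → ≤-antisym (<row⇒<col (cancel f))
             (≮⇒≥ λ y< → ¬g (subst (_≤ row (suc y + l) + a) arm (+-monoˡ-≤ a (<col⇒<row y<)))))
    where
    cancel : ∀ {r} → row y ≤ r + a → x < r
    cancel le = +-cancelʳ-≤ a _ _ (subst (_≤ _) (sym arm) le)

  -- For `x = row (y + l) + a`, `F y` puts `(x , y)` outside the diagram, and the failure of `G` at
  -- the preceding row puts the box just below it inside.
  col⇔rise : ∀ y → col (row (y + l) + a) ≡ y ⇔ Rise F G y
  col⇔rise zero = mk⇔
    (λ e → ≮⇒≥ λ x<r → <-irrefl (sym e) (<row⇒<col x<r))
    (λ f → n≤0⇒n≡0 (≮⇒≥ λ 0<t → ≤⇒≯ f (<col⇒<row 0<t)))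
  col⇔rise (suc z) = mk⇔
    (λ e → (≮⇒≥ λ x<r → <-irrefl (sym e) (<row⇒<col x<r)) , <⇒≱ (<col⇒<row (≤-reflexive (sym e))))
    (λ (f , ¬g) → ≤-antisym (≮⇒≥ λ y<t → ≤⇒≯ f (<col⇒<row y<t)) (<row⇒<col (≰⇒> ¬g)))

  InBox OutBox : Pred Box 0ℓ
  InBox  c = boxes D c × ArmIn D c a × LegIn D c l
  OutBox c = complement D c × ArmOut D c a × LegOut D c l

  InBox⇔fall : ∀ c → InBox c ⇔ ∃ λ y → c ≡ (row y ∸ suc a , y) × Fall F G y
  InBox⇔fall c@(x , y) = mk⇔
    (λ (c∈ , arm , leg) → let e = to (ArmIn⇔ c∈) arm in
      y , cong (_, y) (trans (sym (m+n∸n≡m x a)) (cong (_∸ suc a) e)) ,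
      to (leg⇔fall e) (to (LegIn⇔ c∈) leg))
    λ { (y , refl , fall@(_ , ¬g)) →
      -- The failure of `G y` gives `a < row y`, so the truncated subtraction is exact.
      let e : suc (row y ∸ suc a) + a ≡ row y
          e = trans (sym (+-suc _ a)) (m∸n+n≡m (≤-<-trans (m≤n+m a _) (≰⇒> ¬g)))
          c∈ = from ∈⇔<row (m+n≤o⇒m≤o _ (≤-reflexive e))
      in c∈ , from (ArmIn⇔ c∈) e , from (LegIn⇔ c∈) (from (leg⇔fall e) fall) }

  -- The index is the height of the column of `c`, not its row: leg `l` places `c` exactly `l` rows
  -- above the lowest complement box of that column.
  OutBox⇔rise : ∀ c → OutBox c ⇔ ∃ λ y → c ≡ (row (y + l) + a , y + l) × Rise F G y
  OutBox⇔rise c@(x , y) = mk⇔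
    (λ (c∉ , arm , leg) → fromEqs (to (ArmOut⇔ c∉) arm) (to (LegOut⇔ c∉) leg))
    λ { (z , refl , rise) →
      let c∉ = ≤⇒≯ (m≤m+n _ a) ∘ to ∈⇔<row
      in c∉ , from (ArmOut⇔ c∉) refl , from (LegOut⇔ c∉) (cong (_+ l) (from (col⇔rise z) rise)) }
    where
    fromEqs : row y + a ≡ x → col x + l ≡ y → ∃ λ z → c ≡ (row (z + l) + a , z + l) × Rise F G z
    fromEqs arm leg = col x , cong₂ _,_ (sym arm′) (sym leg) , to (col⇔rise (col x)) (cong col arm′)
      where
      arm′ : row (col x + l) + a ≡ x
      arm′ = trans (cong (λ y → row y + a) leg) arm

  count : ∃ λ n → Count InBox n × Count OutBox (suc n)
  count =
    let n , falls , rises = rises≡1+falls (proj₁ height) G-eventually in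
    -- The vertical coordinate recovers the index, so both parametrisations are injective.
    n , Count-image (cong proj₂) InBox⇔fall falls
      , Count-image (+-cancelʳ-≡ l _ _ ∘ cong proj₂) OutBox⇔rise rises
    where
    G-eventually : ∀ y → proj₁ height ≤ y → G y
    -- Above the diagram the left side of `G y` is `0`.
    G-eventually y h≤y = subst (_≤ row (suc y + l) + a) (sym (row-vanishes y h≤y)) z≤n

theorem1p3 : (D : YoungDiagram) (a l : ℕ) →
    ∃ λ n →
    Count (λ c → boxes D c × ArmIn D c a × LegIn D c l) n ×
    Count (λ c → complement D c × ArmOut D c a × LegOut D c l) (suc n)
theorem1p3 D a l = ArmLeg.count D a l
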